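{- For every integer $k \ge 5$ there exists a graph $H$ with $Q_{k-1} \subseteq H \subseteq Q_k$ such that there is no $n$ for which the edge set of $Q_n$ can be partitioned into (equivalently, covered by) pairwise edge-disjoint copies of $H$.
   Context: $Q_n$ denotes the $n$-dimensional hypercube: vertex set $\{0,1\}^n$, two vertices adjacent iff they differ in exactly one coordinate. $Q_{k-1} \subseteq H \subseteq Q_k$ means $H$ is a subgraph of $Q_k$ that contains a subgraph isomorphic to $Q_{k-1}$. A copy of $H$ in $Q_n$ is any subgraph of $Q_n$ isomorphic to $H$ (not required to be induced); the copies in the cover must be pairwise edge-disjoint and every edge of $Q_n$ must lie in one of them. -}

module Defs where

open import Data.Nat using (ℕ; _≤_; _∸_)
open import Data.Bool using (Bool; true)
open import Data.Fin using (Fin)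
open import Data.Vec using (Vec; lookup)
open import Data.Product using (Σ; _×_; ∃)
open import Relation.Binary.PropositionalEquality using (_≡_; _≢_)
open import Relation.Nullary using (¬_)

Vertex : ℕ → Set
Vertex n = Vec Bool n

Adj : ∀ {n} → Vertex n → Vertex n → Set
Adj {n} u v = Σ (Fin n) λ i →
  (lookup u i ≢ lookup v i) × (∀ j → j ≢ i → lookup u j ≡ lookup v j)

-- A subgraph H of Q_k, given by its (symmetric) edge relation, every edge
-- of which is an edge of Q_k.  Vertices of H are the endpoints of its edges.
record Subgraph (k : ℕ) : Set where
  field
    edge    : Vertex k → Vertex k → Bool
    sym     : ∀ u v → edge u v ≡ true → edge v u ≡ true
    ⊆cube   : ∀ u v → edge u v ≡ true → Adj u v
open Subgraph public

InV : ∀ {k} → Subgraph k → Vertex k → Set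
InV H u = ∃ λ w → edge H u w ≡ true

ContainsCube : ∀ {k} → (m : ℕ) → Subgraph k → Set
ContainsCube {k} m H = Σ (Vertex m → Vertex k) λ ψ →
  (∀ x y → ψ x ≡ ψ y → x ≡ y) ×
  (∀ x y → Adj x y → edge H (ψ x) (ψ y) ≡ true)

record Copy {k : ℕ} (n : ℕ) (H : Subgraph k) : Set where
  field
    φ      : Vertex k → Vertex n
    inj    : ∀ u u' → InV H u → InV H u' → φ u ≡ φ u' → u ≡ u'
    hom    : ∀ u v → edge H u v ≡ true → Adj (φ u) (φ v)
open Copy public

Covers : ∀ {k n} {H : Subgraph k} → Copy n H → Vertex n → Vertex n → Set
Covers {H = H} c x y = ∃ λ u → ∃ λ v →
  (edge H u v ≡ true) × (φ c u ≡ x) × (φ c v ≡ y)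

record Decomposition {k : ℕ} (n : ℕ) (H : Subgraph k) : Set where
  field
    m        : ℕ
    copies   : Fin m → Copy n H
    cover    : ∀ x y → Adj x y → ∃ λ j → Covers (copies j) x y
    disjoint : ∀ j j' x y → Covers (copies j) x y → Covers (copies j') x y → j ≡ j'

{-# OPTIONS --safe #-}
-- Let H be the cube Q_k with the zero vertex deleted, so that H has 2^(k-1) - 1
-- edges in each direction.  Opposite edges of a 4-cycle of Q_n are parallel, and
-- any two parallel edges of H are linked through 4-cycles of H, so a copy of H
-- maps all edges of one direction to edges of one direction.  In a decomposition,
-- the 2^(n-1) edges of Q_n in direction 0 would hence split into classes of size
-- 2^(k-1) - 1, which is odd and greater than 1.
module Submission where

open import Defs hiding (sym)
open import Data.Bool using (Bool; true; false; not)
open import Data.Bool.Properties as Bool using (¬-not; not-¬)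
open import Data.Fin using (Fin; zero; suc; punchIn; punchOut)
open import Data.Fin.Permutation using (↔⇒≡)
open import Data.Fin.Properties as Fin
  using (any?; all?; *↔×; 2↔Bool; 0≢1+n; suc-injective;
         punchIn-injective; punchInᵢ≢i; punchIn-punchOut)
open import Data.Nat using (ℕ; zero; suc; pred; _≤_; _∸_; _+_; _^_; s≤s; z≤n)
open import Data.Nat.Coprimality using (Coprime; coprime-divisor)
open import Data.Nat.Divisibility using (_∣_; ∣-trans; ∣1⇒≡1; ∣m+n∣m⇒∣n; m∣m*n; divides)
open import Data.Nat.Properties using (suc-pred; m^n≢0; ^-monoʳ-≤; 1+n≰n; +-comm; module ≤-Reasoning)
open import Data.Product using (Σ; ∃; _×_; _,_; proj₁; proj₂)
open import Data.Vec using ([]; _∷_; head; tail; lookup; insertAt; removeAt; replicate)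
open import Data.Vec.Properties
  using (≡-dec; ∷-injectiveʳ; insertAt-lookup; insertAt-punchIn;
         removeAt-insertAt; insertAt-removeAt; tabulate∘lookup; tabulate-cong)
open import Data.Product.Function.NonDependent.Propositional using (_×-↔_)
open import Function using (_∘_; _↔_; Inverse; Injection; mk↔ₛ′; mk⤖)
open import Function.Definitions using (Injective; StrictlySurjective)
open import Function.Consequences.Propositional using (strictlySurjective⇒surjective)
open import Function.Properties.Bijection using (⤖⇒↔)
open import Function.Properties.Inverse using (↔-sym; ↔-trans; ↔⇒↣)
open import Relation.Nullary using (¬_; Dec; yes; no; does; contradiction; ¬?; _×-dec_; _→-dec_)
open import Relation.Nullary.Decidable using (dec-true)
open import Relation.Binary.PropositionalEquality
  using (_≡_; _≢_; refl; sym; trans; cong; cong₂; subst; ≢-sym; module ≡-Reasoning)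

private
  variable
    n p : ℕ

-- Adjacency in the cube and normal forms of edges

lookup-ext : {u v : Vertex n} → (∀ i → lookup u i ≡ lookup v i) → u ≡ v
lookup-ext {u = u} {v} eq =
  trans (sym (tabulate∘lookup u)) (trans (tabulate-cong eq) (tabulate∘lookup v))

_≟ᵥ_ : (u v : Vertex n) → Dec (u ≡ v)
_≟ᵥ_ = ≡-dec Bool._≟_

Adj? : (u v : Vertex n) → Dec (Adj u v)
Adj? u v = any? λ i →
  ¬? (lookup u i Bool.≟ lookup v i) ×-dec
  all? λ j → ¬? (j Fin.≟ i) →-dec (lookup u j Bool.≟ lookup v j)

Adj-sym : ∀ (u v : Vertex n) → Adj u v → Adj v u
Adj-sym u v (i , ≢i , ≡j) = i , ≢-sym ≢i , λ j j≢i → sym (≡j j j≢i)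

Adj-∷ : ∀ {u v : Vertex n} b → Adj u v → Adj (b ∷ u) (b ∷ v)
Adj-∷ b (i , ≢i , ≡j) = suc i , ≢i , λ where
  zero    _   → refl
  (suc j) j≢i → ≡j j (j≢i ∘ cong suc)

Adj-flip : ∀ (z : Vertex n) i {b b′} → b ≢ b′ → Adj (insertAt z i b) (insertAt z i b′)
Adj-flip z       zero    b≢b′ = zero , b≢b′ , λ where
  zero    0≢0 → contradiction refl 0≢0
  (suc j) _   → refl
Adj-flip (a ∷ z) (suc i) b≢b′ = Adj-∷ a (Adj-flip z i b≢b′)

Adj-insertAt : ∀ {u v : Vertex n} i b → Adj u v → Adj (insertAt u i b) (insertAt v i b)
Adj-insertAt                         zero    b a = Adj-∷ b a
Adj-insertAt {u = x ∷ u} {y ∷ v} (suc i) b (zero , x≢y , ≡j)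
  rewrite lookup-ext {u = u} {v} (λ j → ≡j (suc j) λ ()) = zero , x≢y , λ where
    zero    0≢0 → contradiction refl 0≢0
    (suc j) _   → refl
Adj-insertAt {u = x ∷ u} {y ∷ v} (suc i) b (suc l , ≢l , ≡j)
  rewrite ≡j zero 0≢1+n =
    Adj-∷ y (Adj-insertAt i b (l , ≢l , λ j j≢l → ≡j (suc j) (j≢l ∘ suc-injective)))

-- Normal form of an oriented edge: its direction `i`, its base `z` with coordinate `i` removed, and
-- the bit `b` at its first end.
Adj⇒flip : (u v : Vertex (suc n)) → Adj u v →
  ∃ λ i → ∃ λ z → ∃ λ b → (u ≡ insertAt z i b) × (v ≡ insertAt z i (not b))
Adj⇒flip u v (i , ≢i , ≡j) =
  i , removeAt u i , lookup u i , sym (insertAt-removeAt u i) , lookup-ext v≡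
  where
  v≡ : ∀ j → lookup v j ≡ lookup (insertAt (removeAt u i) i (not (lookup u i))) j
  v≡ j with i Fin.≟ j
  ... | yes refl = trans (¬-not (≢-sym ≢i)) (sym (insertAt-lookup (removeAt u i) i _))
  ... | no i≢j rewrite sym (punchIn-punchOut i≢j) = begin
    lookup v (punchIn i l)                                   ≡⟨ sym (≡j _ (punchInᵢ≢i i l)) ⟩
    lookup u (punchIn i l)                                   ≡⟨ cong (λ w → lookup w (punchIn i l)) (sym (insertAt-removeAt u i)) ⟩
    lookup (insertAt (removeAt u i) i (lookup u i)) (punchIn i l)  ≡⟨ insertAt-punchIn (removeAt u i) i _ l ⟩
    lookup (removeAt u i) l                                  ≡⟨ sym (insertAt-punchIn (removeAt u i) i _ l) ⟩
    lookup (insertAt (removeAt u i) i (not (lookup u i))) (punchIn i l) ∎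
    where
    open ≡-Reasoning
    l = punchOut i≢j

-- If the directions differed, coordinate `i` would be constant along the second edge, yet it
-- changes from `b` to `not b` along the first. Once they agree, `z` and `b` are read off from the
-- first end.
flip-unique : ∀ (z z′ : Vertex n) i i′ b b′ →
  insertAt z i b ≡ insertAt z′ i′ b′ → insertAt z i (not b) ≡ insertAt z′ i′ (not b′) →
  i ≡ i′ × z ≡ z′ × b ≡ b′
flip-unique z z′ i i′ b b′ eq eq′ with i′ Fin.≟ i
... | yes refl =
  refl ,
  trans (sym (removeAt-insertAt z i b)) (trans (cong (λ w → removeAt w i) eq) (removeAt-insertAt z′ i b′)) ,
  trans (sym (insertAt-lookup z i b)) (trans (cong (λ w → lookup w i) eq) (insertAt-lookup z′ i b′))
... | no i′≢i rewrite sym (punchIn-punchOut i′≢i) = contradiction b≡not-b (not-¬ refl)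
  where
  open ≡-Reasoning
  l = punchOut i′≢i
  j = punchIn i′ l
  b≡not-b : b ≡ not b
  b≡not-b = begin
    b                                  ≡⟨ sym (insertAt-lookup z j b) ⟩
    lookup (insertAt z j b) j          ≡⟨ cong (λ w → lookup w j) eq ⟩
    lookup (insertAt z′ i′ b′) j       ≡⟨ insertAt-punchIn z′ i′ b′ l ⟩
    lookup z′ l                        ≡⟨ sym (insertAt-punchIn z′ i′ (not b′) l) ⟩
    lookup (insertAt z′ i′ (not b′)) j ≡⟨ cong (λ w → lookup w j) (sym eq′) ⟩
    lookup (insertAt z j (not b)) j    ≡⟨ insertAt-lookup z j (not b) ⟩
    not b                              ∎

-- The cube with the zero vertex deleted

zeros : Vertex n
zeros = replicate _ false

insertAt-zeros : (i : Fin (suc n)) → insertAt zeros i false ≡ zeros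
insertAt-zeros         zero    = refl
insertAt-zeros {suc n} (suc i) = cong (false ∷_) (insertAt-zeros i)

insertAt-≢zeros : {z : Vertex n} → z ≢ zeros → ∀ i b → insertAt z i b ≢ zeros
insertAt-≢zeros {z = z} z≢0 i b eq = z≢0 (begin
  z                                    ≡⟨ sym (removeAt-insertAt z i b) ⟩
  removeAt (insertAt z i b) i          ≡⟨ cong (λ w → removeAt w i) (trans eq (sym (insertAt-zeros i))) ⟩
  removeAt (insertAt zeros i false) i  ≡⟨ removeAt-insertAt zeros i false ⟩
  zeros                                ∎)
  where open ≡-Reasoning

-- Over the base `zeros`, the end whose bit is `false` is the zero vertex. Hence the surviving edges
-- of direction `i` are exactly those over nonzero bases.
flip-≢zeros : ∀ (z : Vertex n) i b →
  insertAt z i b ≢ zeros → insertAt z i (not b) ≢ zeros → z ≢ zeros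
flip-≢zeros z i false ≢0 _  refl = ≢0 (insertAt-zeros i)
flip-≢zeros z i true  _  ≢0 refl = ≢0 (insertAt-zeros i)

Edge : (u v : Vertex n) → Set
Edge u v = Adj u v × u ≢ zeros × v ≢ zeros

-- Abstract because unification is intractable once this unfolds.
abstract
  Edge? : (u v : Vertex n) → Dec (Edge u v)
  Edge? u v = Adj? u v ×-dec ¬? (u ≟ᵥ zeros) ×-dec ¬? (v ≟ᵥ zeros)

does⇒ : ∀ {A : Set} (a? : Dec A) → does a? ≡ true → A
does⇒ (yes a) _ = a

puncturedCube : ∀ k → Subgraph k
puncturedCube k = record
  { edge  = λ u v → does (Edge? u v)
  ; sym   = λ u v e → let (a , u≢0 , v≢0) = does⇒ (Edge? u v) e in
                      dec-true (Edge? v u) (Adj-sym u v a , v≢0 , u≢0)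
  ; ⊆cube = λ u v e → proj₁ (does⇒ (Edge? u v) e)
  }

-- The face with first coordinate `true` misses the zero vertex, so all its edges survive.
puncturedCube-⊇cube : ∀ k → ContainsCube k (puncturedCube (suc k))
puncturedCube-⊇cube k =
  (true ∷_) , (λ _ _ → ∷-injectiveʳ) ,
  λ x y a → dec-true (Edge? (true ∷ x) (true ∷ y)) (Adj-∷ true a , (λ ()) , (λ ()))

-- Connectivity

cube-connected : (P : Vertex n → Set) →
  (∀ {u v} → Adj u v → P u → P v) → ∀ z z′ → P z → P z′
cube-connected P step []      []        Pz = Pz
-- The first coordinate is corrected first, the others inside the face that it fixes.
cube-connected P step (a ∷ z) (a′ ∷ z′) Pz =
  cube-connected (P ∘ (a′ ∷_)) (step ∘ Adj-∷ a′) z z′ P₁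
  where
  P₁ : P (a′ ∷ z)
  P₁ with a Bool.≟ a′
  ... | yes refl = Pz
  ... | no a≢a′  = step (Adj-flip z zero a≢a′) Pz

-- Any nonzero vertex is adjacent or equal to one in the face {true} × Q_n, which
-- avoids the zero vertex.
puncturedCube-connected : (P : Vertex (suc n) → Set) →
  (∀ {u v} → u ≢ zeros → v ≢ zeros → Adj u v → P u → P v) →
  ∀ z z′ → z ≢ zeros → z′ ≢ zeros → P z → P z′
puncturedCube-connected P step (a ∷ z) (a′ ∷ z′) z≢0 z′≢0 Pz =
  leave a′ z′≢0 (cube-connected (P ∘ (true ∷_))
    (step (λ ()) (λ ()) ∘ Adj-∷ true) z z′ (enter a z≢0 Pz))
  where
  enter : ∀ b → b ∷ z ≢ zeros → P (b ∷ z) → P (true ∷ z)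
  enter true  _  = λ Pz → Pz
  enter false ≢0 = step ≢0 (λ ()) (Adj-flip z zero λ ())
  leave : ∀ b → b ∷ z′ ≢ zeros → P (true ∷ z′) → P (b ∷ z′)
  leave true  _  = λ Pz → Pz
  leave false ≢0 = step (λ ()) ≢0 (Adj-flip z′ zero λ ())

-- Edges of direction 0 and 4-cycles

CrossesZero : (u v : Vertex (suc n)) → Set
CrossesZero u v = head u ≢ head v

crossing-tail : ∀ (u v : Vertex (suc n)) → Adj u v → CrossesZero u v → tail u ≡ tail v
crossing-tail (_ ∷ _) (_ ∷ _) (zero  , _ , ≡j) _   = lookup-ext λ j → ≡j (suc j) λ ()
crossing-tail (_ ∷ _) (_ ∷ _) (suc i , _ , ≡j) x≢y = contradiction (≡j zero 0≢1+n) x≢y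

-- The edge may run either way between the two faces; `b` records which end lies in the face
-- `false`.
crossing-split : (e : Bool → Vertex (suc n)) → Adj (e false) (e true) →
  CrossesZero (e false) (e true) → ∃ λ b →
  (e b ≡ false ∷ tail (e false)) × (e (not b) ≡ true ∷ tail (e false))
crossing-split e a x
  with e false in ≡₀ | e true in ≡₁ | x | crossing-tail (e false) (e true) a x
... | false ∷ _ | true  ∷ _ | _   | eq = false , ≡₀ , trans ≡₁ (cong (true ∷_) (sym eq))
... | true  ∷ _ | false ∷ _ | _   | eq = true  , trans ≡₁ (cong (false ∷_) (sym eq)) , ≡₀
... | false ∷ _ | false ∷ _ | f≢f | _  = contradiction refl f≢f
... | true  ∷ _ | true  ∷ _ | t≢t | _  = contradiction refl t≢t

-- A vertex has only one neighbour in direction 0. If `d` and `c` had equal heads, then either `b c`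
-- crosses as well, forcing `a ≡ c`, or `d a` does, forcing `b ≡ d`.
square-parallel : {a b c d : Vertex (suc n)} →
  Adj a b → Adj b c → Adj d a → a ≢ c → b ≢ d → CrossesZero a b → CrossesZero d c
square-parallel {a = x ∷ a} {y ∷ b} {z ∷ c} {w ∷ d} ab bc da a≢c b≢d x≢y refl with z Bool.≟ x
... | yes refl = a≢c (cong (x ∷_) (trans (crossing-tail (x ∷ a) (y ∷ b) ab x≢y) (crossing-tail (y ∷ b) (x ∷ c) bc (≢-sym x≢y))))
... | no z≢x   = b≢d (cong₂ _∷_
  (trans (¬-not (≢-sym x≢y)) (sym (¬-not z≢x)))
  (sym (trans (crossing-tail (z ∷ d) (x ∷ a) da z≢x) (crossing-tail (x ∷ a) (y ∷ b) ab x≢y))))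

-- Directions in a copy of the punctured cube

module _ {k n} (c : Copy (suc n) (puncturedCube (suc k))) where

  private
    E : Fin (suc k) → Vertex k → Bool → Vertex (suc n)
    E i z b = φ c (insertAt z i b)

  Crosses : Fin (suc k) → Vertex k → Set
  Crosses i z = CrossesZero (E i z false) (E i z true)

  edge-flip : ∀ {z} → z ≢ zeros → ∀ i b →
    edge (puncturedCube (suc k)) (insertAt z i b) (insertAt z i (not b)) ≡ true
  edge-flip {z} z≢0 i b = dec-true (Edge? _ _)
    (Adj-flip z i (not-¬ refl) , insertAt-≢zeros z≢0 i b , insertAt-≢zeros z≢0 i (not b))

  edge-insertAt : ∀ {z z′} → z ≢ zeros → z′ ≢ zeros → ∀ i b → Adj z z′ →
    edge (puncturedCube (suc k)) (insertAt z i b) (insertAt z′ i b) ≡ true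
  edge-insertAt z≢0 z′≢0 i b a = dec-true (Edge? _ _)
    (Adj-insertAt i b a , insertAt-≢zeros z≢0 i b , insertAt-≢zeros z′≢0 i b)

  -- `inj` speaks only of endpoints of edges of the subgraph; over a nonzero base, the edge of
  -- direction `i` provides the required neighbour.
  inj-insertAt : ∀ {z z′} → z ≢ zeros → z′ ≢ zeros → ∀ {i i′ b b′} →
    E i z b ≡ E i′ z′ b′ → insertAt z i b ≡ insertAt z′ i′ b′
  inj-insertAt {z} {z′} z≢0 z′≢0 {i} {i′} {b} {b′} = inj c _ _
    (insertAt z i (not b) , edge-flip z≢0 i b) (insertAt z′ i′ (not b′) , edge-flip z′≢0 i′ b′)

  E-opposite-≢ : ∀ {z z′} → z ≢ zeros → z′ ≢ zeros → ∀ i b → E i z b ≢ E i z′ (not b)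
  E-opposite-≢ {z} {z′} z≢0 z′≢0 i b eq = not-¬ refl (begin
    b                                  ≡⟨ sym (insertAt-lookup z i b) ⟩
    lookup (insertAt z i b) i          ≡⟨ cong (λ w → lookup w i) (inj-insertAt z≢0 z′≢0 eq) ⟩
    lookup (insertAt z′ i (not b)) i   ≡⟨ insertAt-lookup z′ i (not b) ⟩
    not b                              ∎)
    where open ≡-Reasoning

  -- The direction `i` edges over `z` and `z′` are opposite sides of a 4-cycle avoiding the zero
  -- vertex, and its diagonals have distinct ends in the image.
  Crosses-adjacent : ∀ i {z z′} → z ≢ zeros → z′ ≢ zeros → Adj z z′ → Crosses i z → Crosses i z′
  Crosses-adjacent i {z} {z′} z≢0 z′≢0 a = square-parallel
    (hom c _ _ (edge-flip z≢0 i false))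
    (hom c _ _ (edge-insertAt z≢0 z′≢0 i true a))
    (hom c _ _ (edge-insertAt z′≢0 z≢0 i false (Adj-sym z z′ a)))
    (E-opposite-≢ z≢0 z′≢0 i false)
    (E-opposite-≢ z≢0 z′≢0 i true)

  crossing-ends : ∀ {i z} → z ≢ zeros → Crosses i z → ∃ λ b →
    (E i z b ≡ false ∷ tail (E i z false)) × (E i z (not b) ≡ true ∷ tail (E i z false))
  crossing-ends {i} {z} z≢0 x = crossing-split (E i z) (hom c _ _ (edge-flip z≢0 i false)) x

  crossing-covers : ∀ {i z y} → z ≢ zeros → Crosses i z → tail (E i z false) ≡ y →
    Covers c (false ∷ y) (true ∷ y)
  crossing-covers {i} z≢0 x refl =
    let b , ≡f , ≡t = crossing-ends z≢0 x in _ , _ , edge-flip z≢0 i b , ≡f , ≡t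

  -- Equal tails mean the same edge of direction 0, so injectivity at both of its ends reduces the
  -- claim to `flip-unique`.
  crossing-unique : ∀ {i i′ z z′} → z ≢ zeros → z′ ≢ zeros → Crosses i z → Crosses i′ z′ →
    tail (E i z false) ≡ tail (E i′ z′ false) → i ≡ i′ × z ≡ z′
  crossing-unique {i} {i′} {z} {z′} z≢0 z′≢0 x x′ eq =
    let b  , ≡f  , ≡t  = crossing-ends z≢0 x
        b′ , ≡f′ , ≡t′ = crossing-ends z′≢0 x′
        i≡i′ , z≡z′ , _ = flip-unique z z′ i i′ b b′
          (inj-insertAt z≢0 z′≢0 (trans ≡f (trans (cong (false ∷_) eq) (sym ≡f′))))
          (inj-insertAt z≢0 z′≢0 (trans ≡t (trans (cong (true ∷_) eq) (sym ≡t′))))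
    in i≡i′ , z≡z′

  covers-crossing : ∀ {y} → Covers c (false ∷ y) (true ∷ y) → ∃ λ i → ∃ λ z →
    z ≢ zeros × Crosses i z × tail (E i z false) ≡ y
  covers-crossing {y} (u , v , e , ≡f , ≡t) with does⇒ (Edge? u v) e
  ... | a , u≢0 , v≢0 with Adj⇒flip u v a
  ... | i , z , b , refl , refl = i , z , flip-≢zeros z i b u≢0 v≢0 , crosses b ≡f ≡t , tail≡ b ≡f ≡t
    where
    crosses : ∀ b → E i z b ≡ false ∷ y → E i z (not b) ≡ true ∷ y → Crosses i z
    crosses false ≡f ≡t rewrite ≡f | ≡t = λ ()
    crosses true  ≡f ≡t rewrite ≡f | ≡t = λ ()
    tail≡ : ∀ b → E i z b ≡ false ∷ y → E i z (not b) ≡ true ∷ y → tail (E i z false) ≡ y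
    tail≡ false ≡f ≡t = cong tail ≡f
    tail≡ true  ≡f ≡t = cong tail ≡t

-- The nonzero bases themselves form a connected punctured cube, so each direction of the copy
-- crosses at all of them or at none.
Crosses-everywhere : ∀ {k} (c : Copy (suc n) (puncturedCube (2 + k))) i {z z′} →
  z ≢ zeros → z′ ≢ zeros → Crosses c i z → Crosses c i z′
Crosses-everywhere c i z≢0 z′≢0 = puncturedCube-connected (Crosses c i)
  (Crosses-adjacent c i) _ _ z≢0 z′≢0

-- Finite enumerations

Vertex-enumeration : ∀ n → Fin (2 ^ n) ↔ Vertex n
Vertex-enumeration zero    = mk↔ₛ′ (λ _ → []) (λ _ → zero) (λ { [] → refl }) (λ { zero → refl })
Vertex-enumeration (suc n) =
  ↔-trans *↔× (↔-trans (2↔Bool ×-↔ Vertex-enumeration n)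
    (mk↔ₛ′ (λ (b , v) → b ∷ v) (λ { (b ∷ v) → b , v }) (λ { (_ ∷ _) → refl }) (λ { (_ , _) → refl })))

-- A bijection from `Fin c` to the elements satisfying `P`, phrased without a subset type so that
-- proofs of `P` are never compared.
record Enumeration {A : Set} (P : A → Set) (c : ℕ) : Set where
  field
    at        : Fin c → A
    injective : ∀ {x y} → at x ≡ at y → x ≡ y
    holds     : ∀ x → P (at x)
    complete  : ∀ {a} → P a → ∃ λ x → at x ≡ a

enumerate-Fin : ∀ {n} {P : Fin n → Set} → (∀ i → Dec (P i)) → ∃ (Enumeration P)
enumerate-Fin {zero}  P? = 0 , record
  { at = λ () ; injective = λ { {()} } ; holds = λ () ; complete = λ { {()} } }
enumerate-Fin {suc n} P? with enumerate-Fin (P? ∘ suc) | P? zero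
... | c , e | yes P0 = suc c , record
  { at        = λ { zero → zero ; (suc x) → suc (at x) }
  ; injective = λ { {zero} {zero} _ → refl ; {suc x} {suc y} eq → cong suc (injective (suc-injective eq)) }
  ; holds     = λ { zero → P0 ; (suc x) → holds x }
  ; complete  = λ { {zero} _ → zero , refl
                  ; {suc i} Pi → let x , eq = complete Pi in suc x , cong suc eq }
  } where open Enumeration e
... | c , e | no ¬P0 = c , record
  { at        = suc ∘ at
  ; injective = injective ∘ suc-injective
  ; holds     = holds
  ; complete  = λ { {zero} P0 → contradiction P0 ¬P0
                  ; {suc i} Pi → let x , eq = complete Pi in x , cong suc eq }
  } where open Enumeration e

module _ {A : Set} {c : ℕ} (iso : Fin c ↔ A) where
  open Inverse iso

  enumerate : {P : A → Set} → (∀ a → Dec (P a)) → ∃ (Enumeration P)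
  enumerate {P} P? with enumerate-Fin (P? ∘ to)
  ... | d , e = d , record
    { at        = to ∘ at
    ; injective = injective ∘ Injection.injective (↔⇒↣ iso)
    ; holds     = holds
    ; complete  = λ {a} Pa → let x , eq = complete (subst P (sym (strictlyInverseˡ a)) Pa)
                             in x , trans (cong to eq) (strictlyInverseˡ a)
    } where open Enumeration e

enumerate-≢ : ∀ {A : Set} {c} → Fin (suc c) ↔ A → (a : A) → Enumeration (_≢ a) c
enumerate-≢ iso a = record
  { at        = to ∘ punchIn (from a)
  ; injective = punchIn-injective (from a) _ _ ∘ Injection.injective (↔⇒↣ iso)
  ; holds     = λ x eq → punchInᵢ≢i (from a) x (sym (trans (sym (cong from eq)) (strictlyInverseʳ _)))
  ; complete  = λ {b} b≢a →
      let from≢ : from a ≢ from b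
          from≢ eq = b≢a (trans (sym (strictlyInverseˡ b)) (trans (cong to (sym eq)) (strictlyInverseˡ a)))
      in punchOut from≢ , trans (cong to (punchIn-punchOut from≢)) (strictlyInverseˡ b)
  } where open Inverse iso

-- Counting the edges of direction 0

decomposition⇒∣ : ∀ {k} → suc p ≡ 2 ^ suc k →
  Decomposition (suc n) (puncturedCube (2 + k)) → p ∣ 2 ^ n
-- An edge of direction 0 is named by its tail, one of `2 ^ n` vertices. The bijection `g` sends a
-- crossing class and a nonzero base to such a tail, so `2 ^ n ≡ c * p`.
decomposition⇒∣ {p} {n} {k} p+1≡ D = divides c
  (↔⇒≡ (↔-trans (Vertex-enumeration n) (↔-sym (↔-trans *↔× (⤖⇒↔ (mk⤖ (g-injective , strictlySurjective⇒surjective g-surjective)))))))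
  where
  open Decomposition D

  Class : Set
  Class = Fin m × Fin (2 + k)

  Crossing : Class → Vertex (suc k) → Set
  Crossing (j , i) = Crosses (copies j) i

  base : Class → Vertex (suc k) → Vertex n
  base (j , i) z = tail (φ (copies j) (insertAt z i false))

  base-injective : ∀ {t t′ z z′} → z ≢ zeros → z′ ≢ zeros → Crossing t z → Crossing t′ z′ →
    base t z ≡ base t′ z′ → t ≡ t′ × z ≡ z′
  base-injective {j , i} {j′ , i′} z≢0 z′≢0 x x′ eq
    -- Equal tails make both copies cover the same edge, so disjointness identifies the copies.
    with refl ← disjoint j j′ _ _ (crossing-covers (copies j) z≢0 x eq)
                                  (crossing-covers (copies j′) z′≢0 x′ refl)
    with refl , z≡z′ ← crossing-unique (copies j) z≢0 z′≢0 x x′ eq = refl , z≡z′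

  -- The all-`true` vertex is a nonzero test base: by `Crosses-everywhere` it decides for the whole
  -- class.
  crossings : ∃ (Enumeration (λ t → Crossing t (replicate _ true)))
  crossings = enumerate *↔× λ _ → ¬? (_ Bool.≟ _)

  c = proj₁ crossings
  module C = Enumeration (proj₂ crossings)
  -- The nonzero bases number `2 ^ suc k` minus one, which is `p`.
  module Z = Enumeration
    (enumerate-≢ (subst (λ s → Fin s ↔ Vertex (suc k)) (sym p+1≡) (Vertex-enumeration (suc k))) zeros)

  crosses : ∀ s q → Crossing (C.at s) (Z.at q)
  crosses s q = Crosses-everywhere (copies (proj₁ (C.at s))) _ (λ ()) (Z.holds q) (C.holds s)

  g : Fin c × Fin p → Vertex n
  g (s , q) = base (C.at s) (Z.at q)

  g-injective : Injective _≡_ _≡_ g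
  g-injective {s , q} {s′ , q′} eq =
    let t≡t′ , z≡z′ = base-injective (Z.holds q) (Z.holds q′) (crosses s q) (crosses s′ q′) eq
    in cong₂ _,_ (C.injective t≡t′) (Z.injective z≡z′)

  g-surjective : StrictlySurjective _≡_ g
  g-surjective y =
    let j , cov = cover (false ∷ y) (true ∷ y) (Adj-flip y zero λ ())
        i , z , z≢0 , x , base≡ = covers-crossing (copies j) cov
        s , at-s = C.complete {j , i} (Crosses-everywhere (copies j) i z≢0 (λ ()) x)
        q , at-q = Z.complete z≢0
    in (s , q) , trans (cong₂ base at-s at-q) base≡

-- Divisibility and the contradiction

coprime-∣^ : ∀ {d a} → Coprime d a → ∀ n → d ∣ a ^ n → d ∣ 1
coprime-∣^ cop zero    d∣ = d∣
coprime-∣^ cop (suc n) d∣ = coprime-∣^ cop n (coprime-divisor cop d∣)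

-- A common divisor of `p` and `a` divides both `p` and `p + 1`.
pred-coprime : ∀ {a} n → suc p ≡ a ^ suc n → Coprime p a
pred-coprime {p} {a} n p+1≡ {d} (d∣p , d∣a) = ∣1⇒≡1
  (∣m+n∣m⇒∣n (subst (d ∣_) (trans (sym p+1≡) (+-comm 1 p)) (∣-trans d∣a (m∣m*n (a ^ n)))) d∣p)

puncturedCube-no-decomposition : ∀ k n → ¬ Decomposition (suc n) (puncturedCube (3 + k))
-- The class size `q` divides `2 ^ n` and is coprime to 2, so it is 1, whereas `suc q` is at least
-- 4.
puncturedCube-no-decomposition k n D = 1+n≰n {2} (begin
  3             ≤⟨ s≤s (s≤s (s≤s z≤n)) ⟩
  2 ^ 2         ≤⟨ ^-monoʳ-≤ 2 {2} {2 + k} (s≤s (s≤s z≤n)) ⟩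
  2 ^ (2 + k)   ≡⟨ sym q+1≡ ⟩
  suc q         ≡⟨ cong suc q≡1 ⟩
  2             ∎)
  where
  open ≤-Reasoning
  q = pred (2 ^ (2 + k))
  q+1≡ : suc q ≡ 2 ^ (2 + k)
  q+1≡ = suc-pred (2 ^ (2 + k)) {{m^n≢0 2 (2 + k)}}
  q≡1 : q ≡ 1
  q≡1 = ∣1⇒≡1 (coprime-∣^ (pred-coprime (1 + k) q+1≡) n (decomposition⇒∣ {k = suc k} q+1≡ D))

theorem1p7 : ∀ (k : ℕ) → 5 ≤ k →
    Σ (Subgraph k) λ H → ContainsCube (k ∸ 1) H × (∀ (n : ℕ) → 1 ≤ n → ¬ Decomposition n H)
-- In dimension `3 + k` the class size `2 ^ (2 + k)` minus one is at least 3.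
theorem1p7 (suc (suc (suc k))) _ =
  puncturedCube (3 + k) , puncturedCube-⊇cube (2 + k) ,
  λ { (suc n) _ → puncturedCube-no-decomposition k n }
theorem1p7 1 (s≤s ())
theorem1p7 2 (s≤s (s≤s ()))
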